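{- A monounary algebra $\mathcal{A}$ is homogeneous if and only if there exist a cycle-free monounary algebra $\mathcal{A}_1$ and a locally finite ultrahomogeneous monounary algebra $\mathcal{A}_2$ (where either one of $\mathcal{A}_1,\mathcal{A}_2$ is allowed to be empty) such that $\mathcal{A}\cong\mathcal{A}_1+\mathcal{A}_2$.
   Context: A monounary algebra is a pair $\mathcal{A}=(A;\theta)$ where $A$ is a nonempty set (of arbitrary cardinality) and $\theta\colon A\to A$. Subalgebras are nonempty subsets closed under $\theta$; isomorphisms are bijections commuting with the operations. $\mathcal{A}_1+\mathcal{A}_2$ denotes the disjoint union. An element $x$ is cyclic if $\theta^n(x)=x$ for some $n\geq 1$; $\mathcal{A}$ is cycle-free if it has no cyclic elements. $\mathcal{A}$ is locally finite if every finitely generated subalgebra is finite. $\mathcal{A}$ is ultrahomogeneous if every isomorphism between finitely generated subalgebras of $\mathcal{A}$ extends to an automorphism of $\mathcal{A}$. $\mathcal{A}$ is $n$-homogeneous if every isomorphism between subalgebras of $\mathcal{A}$ of size $n$ extends to an automorphism of $\mathcal{A}$, and homogeneous if it is $n$-homogeneous for every $n\geq 1$ (i.e. every isomorphism between finite subalgebras extends to an automorphism). -}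

module Defs where

open import Level using (Level; suc)
open import Algebra.Core using (Op₁)
open import Algebra.Morphism.Definitions using (Homomorphic₁)
open import Data.Fin.Base using (Fin)
open import Data.List.Base using (List)
open import Data.List.Membership.Propositional using () renaming (_∈_ to _∈ₗ_)
open import Data.Nat.Base using (ℕ; _≥_)
open import Data.Product.Base using (Σ; ∃; _×_; _,_; proj₁)
open import Data.Sum.Base using (_⊎_; map)
import Function.Endo.Propositional as Endo
open import Function.Bundles using (_⤖_; module Bijection)
open import Relation.Binary.PropositionalEquality.Core using (_≡_)
open import Relation.Nullary.Negation.Core using (¬_)
open import Relation.Unary using (Pred; _∈_; _≐_; Satisfiable; Irrelevant)

private
  variable
    a : Level

-- The carrier may be empty, so that an empty summand of a disjoint union is
-- covered; nonemptiness is the separate predicate NonEmpty.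
record MonounaryAlgebra (a : Level) : Set (suc a) where
  field
    Carrier : Set a
    θ       : Op₁ Carrier

open MonounaryAlgebra public

NonEmpty : MonounaryAlgebra a → Set a
NonEmpty 𝒜 = Carrier 𝒜

infix 4 _≅_

record _≅_ (𝒜 ℬ : MonounaryAlgebra a) : Set a where
  field
    bijection : Carrier 𝒜 ⤖ Carrier ℬ

  open Bijection bijection public using (to)

  field
    homo : Homomorphic₁ (Carrier 𝒜) (Carrier ℬ) _≡_ to (θ 𝒜) (θ ℬ)

Automorphism : MonounaryAlgebra a → Set a
Automorphism 𝒜 = 𝒜 ≅ 𝒜

infixr 5 _⊕_

_⊕_ : MonounaryAlgebra a → MonounaryAlgebra a → MonounaryAlgebra a
𝒜 ⊕ ℬ = record
  { Carrier = Carrier 𝒜 ⊎ Carrier ℬ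
  ; θ       = map (θ 𝒜) (θ ℬ)
  }

-- Membership is required to be proof-irrelevant so that Σ (Carrier 𝒜) ∣_∣ has
-- exactly one element for each member of the subset.
record Subalgebra (𝒜 : MonounaryAlgebra a) : Set (suc a) where
  field
    ∣_∣        : Pred (Carrier 𝒜) a
    irrelevant : Irrelevant ∣_∣
    nonempty   : Satisfiable ∣_∣
    closed     : ∀ {x} → x ∈ ∣_∣ → θ 𝒜 x ∈ ∣_∣

open Subalgebra public

algebra : {𝒜 : MonounaryAlgebra a} → Subalgebra 𝒜 → MonounaryAlgebra a
algebra {𝒜 = 𝒜} U = record
  { Carrier = Σ (Carrier 𝒜) ∣ U ∣
  ; θ       = λ (x , x∈U) → θ 𝒜 x , closed U x∈U
  }

data Generated (𝒜 : MonounaryAlgebra a) (xs : List (Carrier 𝒜)) : Pred (Carrier 𝒜) a where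
  generator : ∀ {x} → x ∈ₗ xs → x ∈ Generated 𝒜 xs
  step      : ∀ {x} → x ∈ Generated 𝒜 xs → θ 𝒜 x ∈ Generated 𝒜 xs

FinitelyGenerated : {𝒜 : MonounaryAlgebra a} → Subalgebra 𝒜 → Set a
FinitelyGenerated {𝒜 = 𝒜} U = ∃ λ xs → ∣ U ∣ ≐ Generated 𝒜 xs

HasSize : {𝒜 : MonounaryAlgebra a} → ℕ → Subalgebra 𝒜 → Set a
HasSize n U = Carrier (algebra U) ⤖ Fin n

Finite : {𝒜 : MonounaryAlgebra a} → Subalgebra 𝒜 → Set a
Finite U = ∃ λ n → HasSize n U

Cyclic : (𝒜 : MonounaryAlgebra a) → Pred (Carrier 𝒜) a
Cyclic 𝒜 x = ∃ λ n → n ≥ 1 × (θ 𝒜 ^ n) x ≡ x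
  where open Endo (Carrier 𝒜) using (_^_)

CycleFree : MonounaryAlgebra a → Set a
CycleFree 𝒜 = ∀ x → ¬ Cyclic 𝒜 x

LocallyFinite : MonounaryAlgebra a → Set (suc a)
LocallyFinite 𝒜 = (U : Subalgebra 𝒜) → FinitelyGenerated U → Finite U

ExtendsToAutomorphism : {𝒜 : MonounaryAlgebra a} (U V : Subalgebra 𝒜) →
                        algebra U ≅ algebra V → Set a
ExtendsToAutomorphism {𝒜 = 𝒜} U V φ =
  Σ (Automorphism 𝒜) λ α → ∀ u → _≅_.to α (proj₁ u) ≡ proj₁ (_≅_.to φ u)

Ultrahomogeneous : MonounaryAlgebra a → Set (suc a)
Ultrahomogeneous 𝒜 =
  (U V : Subalgebra 𝒜) → FinitelyGenerated U → FinitelyGenerated V →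
  (φ : algebra U ≅ algebra V) → ExtendsToAutomorphism U V φ

_-Homogeneous_ : ℕ → MonounaryAlgebra a → Set (suc a)
n -Homogeneous 𝒜 =
  (U V : Subalgebra 𝒜) → HasSize n U → HasSize n V →
  (φ : algebra U ≅ algebra V) → ExtendsToAutomorphism U V φ

Homogeneous : MonounaryAlgebra a → Set (suc a)
Homogeneous 𝒜 = ∀ n → n ≥ 1 → n -Homogeneous 𝒜

{-# OPTIONS --safe #-}
-- Every element of a finite subalgebra has a cyclic iterate, so the finite
-- subalgebras of 𝒜 lie in the set 𝒜₂ of elements with a cyclic iterate,
-- where being finite is the same as being finitely generated.  The complement
-- 𝒜₁ of 𝒜₂ is closed under θ as well, and automorphisms of 𝒜 preserve 𝒜₂.
-- Hence an isomorphism of finite subalgebras extends to 𝒜 if and only if it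
-- extends to 𝒜₂: restrict in one direction, add the identity of 𝒜₁ in the other.
module Submission where

open import Defs
open import Algebra.Morphism.Definitions using (Homomorphic₁)
open import Axiom.ExcludedMiddle using (ExcludedMiddle)
open import Data.Empty using (⊥-elim)
open import Data.Fin.Base using (Fin; toℕ)
import Data.Fin.Base as Fin
open import Data.Fin.Properties using (pigeonhole)
open import Data.List.Base
  using (List; map; length; lookup; filter; deduplicate; concatMap; applyUpTo; allFin)
open import Data.List.Membership.Propositional using () renaming (_∈_ to _∈ₗ_)
open import Data.List.Membership.Propositional.Properties
  using (∈-map⁺; ∈-map⁻; ∈-allFin; ∈-lookup; ∈-filter⁺; ∈-filter⁻; ∈-deduplicate⁺;
         ∈-deduplicate⁻; ∈-applyUpTo⁺; ∈-applyUpTo⁻; ∈-concatMap⁺; ∈-concatMap⁻)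
import Data.List.Relation.Unary.All as All
open import Data.List.Relation.Unary.AllPairs using (_∷_)
open import Data.List.Relation.Unary.Any as Any using (index)
open import Data.List.Relation.Unary.Any.Properties using (lookup-index)
open import Data.List.Relation.Unary.Unique.Propositional using (Unique)
open import Data.List.Relation.Unary.Unique.DecPropositional.Properties using (deduplicate-!)
open import Data.Nat.Base using (ℕ; zero; suc; _+_; _∸_; _≥_; s≤s; z≤n)
open import Data.Nat.Properties
  using (n<1+n; <⇒≤; m∸n+n≡m; m<n⇒0<n∸m; m≤n⇒m<n∨m≡n; m<n+m)
open import Data.Product.Base using (Σ; ∃; ∃₂; _×_; _,_; proj₁; proj₂)
open import Data.Sum.Base using (inj₁; inj₂; [_,_])
open import Data.Sum.Function.Propositional using (_⊎-⤖_)
open import Data.Sum.Properties using (inj₁-injective; inj₂-injective)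
open import Function.Base using (_∘_; id)
open import Function.Bundles using (_⇔_; mk⇔; _⤖_; mk⤖; module Bijection)
open import Function.Construct.Composition using (_⤖-∘_)
open import Function.Construct.Identity using (⤖-id)
open import Function.Construct.Symmetry using (⤖-sym)
open import Function.Consequences.Propositional using (strictlySurjective⇒surjective)
open import Function.Definitions using (Injective; StrictlySurjective)
import Function.Endo.Propositional as Endo
open import Level using (Level)
open import Relation.Binary.PropositionalEquality
  using (_≡_; refl; sym; trans; cong; cong-app; subst; module ≡-Reasoning)
open import Relation.Nullary using (¬_; Dec; yes; no)
open import Relation.Nullary.Decidable using (decidable-stable)
open import Relation.Unary using (Pred; _⊆_; _∈_; Irrelevant)

private
  variable
    a : Level
    A : Set a
    𝒜 ℬ 𝒞 : MonounaryAlgebra a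

-- Homomorphisms and isomorphisms

IsHom : (𝒜 ℬ : MonounaryAlgebra a) → (Carrier 𝒜 → Carrier ℬ) → Set a
IsHom 𝒜 ℬ f = Homomorphic₁ (Carrier 𝒜) (Carrier ℬ) _≡_ f (θ 𝒜) (θ ℬ)

Σ-≡ : {P : Pred A a} → Irrelevant P → {p q : Σ A P} → proj₁ p ≡ proj₁ q → p ≡ q
Σ-≡ irr {x , p} {.x , q} refl = cong (x ,_) (irr p q)

mk≅ : {f : Carrier 𝒜 → Carrier ℬ} → IsHom 𝒜 ℬ f →
      Injective _≡_ _≡_ f → StrictlySurjective _≡_ f → 𝒜 ≅ ℬ
mk≅ hom inj surj = record
  { bijection = mk⤖ (inj , strictlySurjective⇒surjective surj)
  ; homo      = hom
  }

≅-trans : 𝒜 ≅ ℬ → ℬ ≅ 𝒞 → 𝒜 ≅ 𝒞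
≅-trans f g = record
  { bijection = g.bijection ⤖-∘ f.bijection
  ; homo      = λ x → trans (cong g.to (f.homo x)) (g.homo (f.to x))
  } where module f = _≅_ f; module g = _≅_ g

module Iso {𝒜 ℬ : MonounaryAlgebra a} (f : 𝒜 ≅ ℬ) where
  open _≅_ f public
  open Bijection bijection public using (injective; strictlySurjective)

  from : Carrier ℬ → Carrier 𝒜
  from y = proj₁ (strictlySurjective y)

  to-from : ∀ y → to (from y) ≡ y
  to-from y = proj₂ (strictlySurjective y)

  from-to : ∀ x → from (to x) ≡ x
  from-to x = injective (to-from (to x))

≅-sym : 𝒜 ≅ ℬ → ℬ ≅ 𝒜
≅-sym {ℬ = ℬ} f = record
  { bijection = ⤖-sym f.bijection
  ; homo      = λ y → f.injective (trans (f.to-from (θ ℬ y))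
                  (sym (trans (f.homo _) (cong (θ ℬ) (f.to-from y)))))
  } where module f = Iso f

-- Iterates and eventually cyclic elements

iterate : (𝒜 : MonounaryAlgebra a) → ℕ → Carrier 𝒜 → Carrier 𝒜
iterate 𝒜 n = θ 𝒜 ^ n
  where open Endo (Carrier 𝒜) using (_^_)

iterate-+ : ∀ (𝒜 : MonounaryAlgebra a) m n x →
            iterate 𝒜 (m + n) x ≡ iterate 𝒜 m (iterate 𝒜 n x)
iterate-+ 𝒜 m n x = cong-app (Endo.^-homo (Carrier 𝒜) (θ 𝒜) m n) x

iterate-homo : {f : Carrier 𝒜 → Carrier ℬ} → IsHom 𝒜 ℬ f →
               ∀ n x → f (iterate 𝒜 n x) ≡ iterate ℬ n (f x)
iterate-homo         hom zero    x = refl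
iterate-homo {ℬ = ℬ} hom (suc n) x = trans (hom _) (cong (θ ℬ) (iterate-homo {ℬ = ℬ} hom n x))

EventuallyCyclic : (𝒜 : MonounaryAlgebra a) → Pred (Carrier 𝒜) a
EventuallyCyclic 𝒜 x = ∃ λ i → Cyclic 𝒜 (iterate 𝒜 i x)

eventuallyCyclic-preserved : {f : Carrier 𝒜 → Carrier ℬ} → IsHom 𝒜 ℬ f →
  ∀ {x} → EventuallyCyclic 𝒜 x → EventuallyCyclic ℬ (f x)
eventuallyCyclic-preserved {𝒜 = 𝒜} {ℬ} {f} hom {x} (i , n , n≥1 , eq) = i , n , n≥1 ,
  (begin
    iterate ℬ n (iterate ℬ i (f x)) ≡⟨ cong (iterate ℬ n) (iterate-homo {ℬ = ℬ} hom i x) ⟨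
    iterate ℬ n (f (iterate 𝒜 i x)) ≡⟨ iterate-homo {ℬ = ℬ} hom n _ ⟨
    f (iterate 𝒜 n (iterate 𝒜 i x)) ≡⟨ cong f eq ⟩
    f (iterate 𝒜 i x)               ≡⟨ iterate-homo {ℬ = ℬ} hom i x ⟩
    iterate ℬ i (f x)               ∎)
  where open ≡-Reasoning

-- The exponents `i` and `n` are kept; injectivity cancels `f` from the equation saying that the
-- `i`-th iterate is cyclic.
eventuallyCyclic-reflected : {f : Carrier 𝒜 → Carrier ℬ} → IsHom 𝒜 ℬ f → Injective _≡_ _≡_ f →
  ∀ {x} → EventuallyCyclic ℬ (f x) → EventuallyCyclic 𝒜 x
eventuallyCyclic-reflected {𝒜 = 𝒜} {ℬ} {f} hom inj {x} (i , n , n≥1 , eq) = i , n , n≥1 ,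
  inj (begin
    f (iterate 𝒜 n (iterate 𝒜 i x)) ≡⟨ iterate-homo {ℬ = ℬ} hom n _ ⟩
    iterate ℬ n (f (iterate 𝒜 i x)) ≡⟨ cong (iterate ℬ n) (iterate-homo {ℬ = ℬ} hom i x) ⟩
    iterate ℬ n (iterate ℬ i (f x)) ≡⟨ eq ⟩
    iterate ℬ i (f x)               ≡⟨ iterate-homo {ℬ = ℬ} hom i x ⟨
    f (iterate 𝒜 i x)               ∎)
  where open ≡-Reasoning

-- The `i`-th iterate of `θ x` is the iterate `suc i` of `x`. This makes the complement of the
-- eventually cyclic elements closed under `θ`.
eventuallyCyclic-θ⁻ : ∀ {x} → EventuallyCyclic 𝒜 (θ 𝒜 x) → EventuallyCyclic 𝒜 x
eventuallyCyclic-θ⁻ {𝒜 = 𝒜} {x} (i , c) = suc i ,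
  subst (Cyclic 𝒜) (sym (iterate-homo {𝒜 = 𝒜} {ℬ = 𝒜} {f = θ 𝒜} (λ _ → refl) i x)) c

-- Among the iterates with exponents 0 to `n` two coincide, say at `i < j`; the `i`-th iterate is
-- then fixed by `j ∸ i` further steps.
finite⇒eventuallyCyclic : ∀ {n} → Carrier 𝒜 ⤖ Fin n → ∀ x → EventuallyCyclic 𝒜 x
finite⇒eventuallyCyclic {𝒜 = 𝒜} {n} bij x
  with i , j , i<j , eq ← pigeonhole (n<1+n n) (λ k → Bijection.to bij (iterate 𝒜 (toℕ k) x))
  = toℕ i , toℕ j ∸ toℕ i , m<n⇒0<n∸m i<j ,
  (begin
    iterate 𝒜 (toℕ j ∸ toℕ i) (iterate 𝒜 (toℕ i) x) ≡⟨ iterate-+ 𝒜 (toℕ j ∸ toℕ i) (toℕ i) x ⟨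
    iterate 𝒜 (toℕ j ∸ toℕ i + toℕ i) x             ≡⟨ cong (λ k → iterate 𝒜 k x) (m∸n+n≡m (<⇒≤ i<j)) ⟩
    iterate 𝒜 (toℕ j) x                             ≡⟨ Bijection.injective bij eq ⟨
    iterate 𝒜 (toℕ i) x                             ∎)
  where open ≡-Reasoning

-- Finite subsets and finitely generated subalgebras

lookup-injective : {xs : List A} → Unique xs → Injective _≡_ _≡_ (lookup xs)
lookup-injective (_ ∷ _)    {Fin.zero}  {Fin.zero}  _  = refl
lookup-injective (x∉xs ∷ _) {Fin.zero}  {Fin.suc j} eq = ⊥-elim (All.lookup x∉xs (∈-lookup j) eq)
lookup-injective (x∉xs ∷ _) {Fin.suc i} {Fin.zero}  eq = ⊥-elim (All.lookup x∉xs (∈-lookup i) (sym eq))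
lookup-injective (_ ∷ xs!)  {Fin.suc i} {Fin.suc j} eq = cong Fin.suc (lookup-injective xs! eq)

module _ (em : ExcludedMiddle a) {A : Set a} {P : Pred A a} (irr : Irrelevant P) where

  -- The list may contain repetitions and elements outside `P`. Excluded middle decides equality and
  -- `P`, so both can be removed, and the positions in the remaining list enumerate `P`.
  listed⇒finite : (xs : List A) → P ⊆ (_∈ₗ xs) → ∃ λ n → Σ A P ⤖ Fin n
  listed⇒finite xs cover = length ys , ⤖-sym (mk⤖
    (lookup-injective (deduplicate-! _≟_ (filter P? xs)) ∘ cong proj₁ , strictlySurjective⇒surjective onto))
    where
    _≟_ : (x y : A) → Dec (x ≡ y)
    x ≟ y = em

    P? : ∀ x → Dec (P x)
    P? x = em

    ys : List A
    ys = deduplicate _≟_ (filter P? xs)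

    element : Fin (length ys) → Σ A P
    element i = lookup ys i , proj₂ (∈-filter⁻ P? {xs = xs} (∈-deduplicate⁻ _≟_ _ (∈-lookup i)))

    onto : StrictlySurjective _≡_ element
    onto (x , p) = index x∈ys , Σ-≡ irr (sym (lookup-index x∈ys))
      where
      x∈ys : x ∈ₗ ys
      x∈ys = ∈-deduplicate⁺ _≟_ (∈-filter⁺ P? (cover p) p)

-- If the `i`-th iterate of `x` returns to itself after `n` steps, the iterates with exponent below
-- `n + i` are closed under `θ`. Concatenating these lists over the generators covers the
-- subalgebra.
eventuallyCyclic⇒locallyFinite : ExcludedMiddle a → (𝒜 : MonounaryAlgebra a) →
  (∀ x → EventuallyCyclic 𝒜 x) → LocallyFinite 𝒜
eventuallyCyclic⇒locallyFinite em 𝒜 ec U (xs , U⊆ , _) =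
  listed⇒finite em (irrelevant U) (concatMap orbit xs) (listed ∘ U⊆)
  where
  orbitLength : Carrier 𝒜 → ℕ
  orbitLength x with i , n , _ ← ec x = n + i

  orbit : Carrier 𝒜 → List (Carrier 𝒜)
  orbit x = applyUpTo (λ k → iterate 𝒜 k x) (orbitLength x)

  ∈-orbit : ∀ x → x ∈ₗ orbit x
  -- The period is positive, so `orbitLength x` is too and exponent 0 is in range.
  ∈-orbit x with i , suc n , _ ← ec x = ∈-applyUpTo⁺ (λ k → iterate 𝒜 k x) (s≤s z≤n)

  orbit-closed : ∀ x {y} → y ∈ₗ orbit x → θ 𝒜 y ∈ₗ orbit x
  orbit-closed x y∈
    with i , n , n≥1 , eq ← ec x
    with k , k< , refl ← ∈-applyUpTo⁻ (λ k → iterate 𝒜 k x) y∈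
    with m≤n⇒m<n∨m≡n k<
  ... | inj₁ sk<   = ∈-applyUpTo⁺ (λ k → iterate 𝒜 k x) sk<
  -- From the last listed iterate, `θ` leads to exponent `n + i`, which wraps around to exponent
  -- `i`; this is in range because `n` is positive.
  ... | inj₂ sk≡   = subst (_∈ₗ applyUpTo (λ k → iterate 𝒜 k x) (n + i))
    (trans (sym eq) (trans (sym (iterate-+ 𝒜 n i x)) (cong (λ k → iterate 𝒜 k x) (sym sk≡))))
    (∈-applyUpTo⁺ (λ k → iterate 𝒜 k x) (m<n+m i n≥1))

  listed : Generated 𝒜 xs ⊆ (_∈ₗ concatMap orbit xs)
  listed (generator x∈) = ∈-concatMap⁺ orbit (Any.map (λ { refl → ∈-orbit _ }) x∈)
  listed (step y∈)      =
    ∈-concatMap⁺ orbit (Any.map (λ {x} → orbit-closed x) (∈-concatMap⁻ orbit {xs = xs} (listed y∈)))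

-- All members together serve as generators.
finite⇒finitelyGenerated : (U : Subalgebra 𝒜) → Finite U → FinitelyGenerated U
finite⇒finitelyGenerated {𝒜 = 𝒜} U (n , bij) = xs , generator ∘ listed , generated
  where
  open Bijection (⤖-sym bij) using (to; strictlySurjective)

  xs : List (Carrier 𝒜)
  xs = map (proj₁ ∘ to) (allFin n)

  listed : ∣ U ∣ ⊆ (_∈ₗ xs)
  listed p with i , eq ← strictlySurjective (_ , p) =
    subst (_∈ₗ xs) (cong proj₁ eq) (∈-map⁺ (proj₁ ∘ to) (∈-allFin i))

  generated : Generated 𝒜 xs ⊆ ∣ U ∣
  generated (generator x∈) with i , _ , refl ← ∈-map⁻ (proj₁ ∘ to) x∈ = proj₂ (to i)
  generated (step p)       = closed U (generated p)

-- Transport of subalgebras and isomorphisms along an embedding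

record Corresponds {ℬ 𝒜 : MonounaryAlgebra a} (ι : Carrier ℬ → Carrier 𝒜)
                   (U : Subalgebra ℬ) (U′ : Subalgebra 𝒜) : Set a where
  field
    image    : ∀ {y} → y ∈ ∣ U ∣ → ι y ∈ ∣ U′ ∣
    preimage : ∀ {x} → x ∈ ∣ U′ ∣ → ∃ λ y → y ∈ ∣ U ∣ × ι y ≡ x

module Embedding {ℬ 𝒜 : MonounaryAlgebra a} (ι : Carrier ℬ → Carrier 𝒜)
  (ι-homo : IsHom ℬ 𝒜 ι) (ι-injective : Injective _≡_ _≡_ ι) where

  -- With `Corresponds` as a hypothesis, the same transport serves both when `U′` is built from `U`
  -- and when `U` is built from `U′`.
  correspondence : (U : Subalgebra ℬ) (U′ : Subalgebra 𝒜) → Corresponds ι U U′ → algebra U ≅ algebra U′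
  correspondence U U′ c = mk≅ {f = λ (y , p) → ι y , image p}
    (λ _ → Σ-≡ (irrelevant U′) (ι-homo _))
    (λ eq → Σ-≡ (irrelevant U) (ι-injective (cong proj₁ eq)))
    (λ (x , p) → let y , q , eq = preimage p in (y , q) , Σ-≡ (irrelevant U′) eq)
    where open Corresponds c

  module _ {U V : Subalgebra ℬ} {U′ V′ : Subalgebra 𝒜}
           (cU : Corresponds ι U U′) (cV : Corresponds ι V V′) where
    private
      module eU = Iso (correspondence U U′ cU)
      module eV = Iso (correspondence V V′ cV)

    push : algebra U ≅ algebra V → algebra U′ ≅ algebra V′
    push φ = ≅-trans (≅-sym (correspondence U U′ cU)) (≅-trans φ (correspondence V V′ cV))

    pull : algebra U′ ≅ algebra V′ → algebra U ≅ algebra V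
    pull φ = ≅-trans (correspondence U U′ cU) (≅-trans φ (≅-sym (correspondence V V′ cV)))

    -- By injectivity it suffices to compare values after `ι`, where `β` becomes `α` and `φ` becomes
    -- `push φ`.
    restrict-extension : (φ : algebra U ≅ algebra V) (α : Automorphism 𝒜) (β : Automorphism ℬ) →
      (∀ y → ι (_≅_.to β y) ≡ _≅_.to α (ι y)) →
      (∀ u → _≅_.to α (proj₁ u) ≡ proj₁ (_≅_.to (push φ) u)) →
      ∀ u → _≅_.to β (proj₁ u) ≡ proj₁ (_≅_.to φ u)
    restrict-extension φ α β comm ext u = ι-injective (trans (comm _) (trans (ext (eU.to u))
      (cong (λ w → ι (proj₁ (_≅_.to φ w))) (eU.from-to u))))

    -- Each member of `U′` is `ι` of a member of `U`, and there `α` is determined by `β`, which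
    -- agrees with `pull φ`.
    lift-extension : (φ : algebra U′ ≅ algebra V′) (α : Automorphism 𝒜) (β : Automorphism ℬ) →
      (∀ y → ι (_≅_.to β y) ≡ _≅_.to α (ι y)) →
      (∀ u → _≅_.to β (proj₁ u) ≡ proj₁ (_≅_.to (pull φ) u)) →
      ∀ u → _≅_.to α (proj₁ u) ≡ proj₁ (_≅_.to φ u)
    lift-extension φ α β comm ext u = begin
      to α (proj₁ u)                     ≡⟨ cong (to α ∘ proj₁) (eU.to-from u) ⟨
      to α (ι (proj₁ (eU.from u)))       ≡⟨ comm _ ⟨
      ι (to β (proj₁ (eU.from u)))       ≡⟨ cong ι (ext (eU.from u)) ⟩
      -- `pull φ` ends with `eV.from`, and `ι` of an underlying element is the underlying element of
      -- its image under `eV.to`, so the two cancel.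
      proj₁ (eV.to (eV.from (to φ (eU.to (eU.from u))))) ≡⟨ cong proj₁ (eV.to-from _) ⟩
      proj₁ (to φ (eU.to (eU.from u)))   ≡⟨ cong (proj₁ ∘ to φ) (eU.to-from u) ⟩
      proj₁ (to φ u)                     ∎
      where open ≡-Reasoning; open _≅_

-- Splitting a homogeneous algebra into cycle-free and cyclic parts

module Decomposition (em : ExcludedMiddle a) (𝒜 : MonounaryAlgebra a) where

  cycleFreePart : MonounaryAlgebra a
  cycleFreePart = record
    { Carrier = Σ (Carrier 𝒜) λ x → ¬ EventuallyCyclic 𝒜 x
    ; θ       = λ (x , ¬c) → θ 𝒜 x , ¬c ∘ eventuallyCyclic-θ⁻ {𝒜 = 𝒜}
    }

  -- The double negation makes membership proof-irrelevant without changing its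
  -- meaning under excluded middle.
  cyclicPart : MonounaryAlgebra a
  cyclicPart = record
    { Carrier = Σ (Carrier 𝒜) λ x → ¬ ¬ EventuallyCyclic 𝒜 x
    ; θ       = λ (x , c) → θ 𝒜 x ,
        λ ¬c → c (¬c ∘ eventuallyCyclic-preserved {𝒜 = 𝒜} {ℬ = 𝒜} {f = θ 𝒜} (λ _ → refl))
    }

  -- A cyclic element is eventually cyclic after 0 steps, also when viewed in `𝒜`.
  cycleFree : CycleFree cycleFreePart
  cycleFree (x , ¬c) cyc =
    ¬c (eventuallyCyclic-preserved {𝒜 = cycleFreePart} {ℬ = 𝒜} {f = proj₁} (λ _ → refl) (0 , cyc))

  proj₁-injective : Injective _≡_ _≡_ (proj₁ {A = Carrier 𝒜} {B = λ x → ¬ ¬ EventuallyCyclic 𝒜 x})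
  -- Any two proofs of a negation are definitionally equal.
  proj₁-injective = Σ-≡ (λ _ _ → refl)

  -- Membership speaks of cycles in `𝒜`; reflection along the inclusion turns them into cycles of
  -- the part itself.
  locallyFinite : LocallyFinite cyclicPart
  locallyFinite = eventuallyCyclic⇒locallyFinite em cyclicPart λ (x , c) →
    eventuallyCyclic-reflected {𝒜 = cyclicPart} {ℬ = 𝒜} (λ _ → refl) proj₁-injective (decidable-stable em c)

  decompose : 𝒜 ≅ cycleFreePart ⊕ cyclicPart
  decompose = ≅-sym (mk≅ {f = join}
    (λ { (inj₁ _) → refl ; (inj₂ _) → refl })
    join-injective
    join-surjective)
    where
    join : Carrier (cycleFreePart ⊕ cyclicPart) → Carrier 𝒜
    join = [ proj₁ , proj₁ ]

    join-injective : Injective _≡_ _≡_ join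
    join-injective {inj₁ _}        {inj₁ _}       refl = refl
    join-injective {inj₁ (_ , ¬c)} {inj₂ (_ , c)} refl = ⊥-elim (c ¬c)
    join-injective {inj₂ (_ , c)} {inj₁ (_ , ¬c)} refl = ⊥-elim (c ¬c)
    join-injective {inj₂ _}        {inj₂ _}       refl = refl

    join-surjective : StrictlySurjective _≡_ join
    join-surjective x with em {EventuallyCyclic 𝒜 x}
    ... | yes c = inj₂ (x , λ ¬c → ¬c c) , refl
    ... | no ¬c = inj₁ (x , ¬c) , refl

  open Embedding {ℬ = cyclicPart} {𝒜 = 𝒜} proj₁ (λ _ → refl) proj₁-injective

  restrict : Automorphism 𝒜 → Automorphism cyclicPart
  restrict α = mk≅ {f = λ (x , c) → α.to x , λ ¬c → c (¬c ∘ eventuallyCyclic-preserved {𝒜 = 𝒜} {ℬ = 𝒜} α.homo)}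
    (λ (x , _) → proj₁-injective (α.homo x))
    (λ eq → proj₁-injective (α.injective (cong proj₁ eq)))
    -- The inverse of `α` is a homomorphism too, so the preimage of `x` stays in the part.
    (λ (x , c) → (α.from x , λ ¬c → c (¬c ∘ eventuallyCyclic-preserved {𝒜 = 𝒜} {ℬ = 𝒜} (_≅_.homo (≅-sym α))))
               , proj₁-injective (α.to-from x))
    where module α = Iso α

  imageSubalgebra : Subalgebra cyclicPart → Subalgebra 𝒜
  imageSubalgebra U = record
    { ∣_∣        = λ x → Σ (¬ ¬ EventuallyCyclic 𝒜 x) λ c → (x , c) ∈ ∣ U ∣
    ; irrelevant = λ (c , p) (_ , q) → cong (c ,_) (irrelevant U p q)
    ; nonempty   = let (x , c) , p = nonempty U in x , c , p
    ; closed     = λ (c , p) → _ , closed U p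
    }

  corresponds : ∀ U → Corresponds proj₁ U (imageSubalgebra U)
  corresponds U = record
    { image    = λ {(_ , c)} p → c , p
    ; preimage = λ {x} (c , p) → (x , c) , p , refl
    }

  nonempty⇒size≥1 : ∀ {n} (U : Subalgebra 𝒜) → HasSize n U → n ≥ 1
  nonempty⇒size≥1 {zero}  U bij with () ← Bijection.to bij (nonempty U)
  nonempty⇒size≥1 {suc n} U bij = s≤s z≤n

  -- Local finiteness makes the subalgebras finite, so their images in `𝒜` fall under homogeneity,
  -- and the automorphism found there is restricted.
  ultrahomogeneous : Homogeneous 𝒜 → Ultrahomogeneous cyclicPart
  ultrahomogeneous hom U V fgU _ φ =
    let n , sU = locallyFinite U fgU
        U′     = imageSubalgebra U
        V′     = imageSubalgebra V
        sU′    = sU ⤖-∘ _≅_.bijection (≅-sym (correspondence U U′ (corresponds U)))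
        φ′     = push (corresponds U) (corresponds V) φ
        -- Homogeneity needs one common size, so the size of `V′` is carried over from `U′` along
        -- `φ′`.
        sV′    = sU′ ⤖-∘ _≅_.bijection (≅-sym φ′)
        α , ext = hom n (nonempty⇒size≥1 U′ sU′) U′ V′ sU′ sV′ φ′
    in restrict α , restrict-extension (corresponds U) (corresponds V) φ α (restrict α) (λ _ → refl) ext

-- Homogeneity of a sum

module Recomposition {𝒜 𝒜₁ 𝒜₂ : MonounaryAlgebra a} (cycleFree : CycleFree 𝒜₁)
  (ultrahomogeneous : Ultrahomogeneous 𝒜₂) (e : 𝒜 ≅ 𝒜₁ ⊕ 𝒜₂) where

  private
    module e = Iso e

  ι : Carrier 𝒜₂ → Carrier 𝒜
  ι = e.from ∘ inj₂

  ι-injective : Injective _≡_ _≡_ ι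
  ι-injective eq = inj₂-injective (trans (sym (e.to-from _)) (trans (cong e.to eq) (e.to-from _)))

  ι-homo : IsHom 𝒜₂ 𝒜 ι
  ι-homo y = _≅_.homo (≅-sym e) (inj₂ y)

  open Embedding {ℬ = 𝒜₂} {𝒜 = 𝒜} ι ι-homo ι-injective

  -- An eventually cyclic element on the `𝒜₁` side would have an iterate that is cyclic in `𝒜₁`.
  eventuallyCyclic⇒∈ι : ∀ {x} → EventuallyCyclic 𝒜 x → ∃ λ y → ι y ≡ x
  eventuallyCyclic⇒∈ι {x} c with e.to x in eq
  ... | inj₂ y = y , trans (cong e.from (sym eq)) (e.from-to x)
  ... | inj₁ z = ⊥-elim (cycleFree _ (proj₂ (
    eventuallyCyclic-reflected {𝒜 = 𝒜₁} {ℬ = 𝒜₁ ⊕ 𝒜₂} (λ _ → refl) inj₁-injective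
      (subst (EventuallyCyclic (𝒜₁ ⊕ 𝒜₂)) eq
        (eventuallyCyclic-preserved {𝒜 = 𝒜} {ℬ = 𝒜₁ ⊕ 𝒜₂} e.homo c)))))

  finite⇒⊆ι : ∀ {n} (U : Subalgebra 𝒜) → HasSize n U → ∀ {x} → x ∈ ∣ U ∣ → ∃ λ y → ι y ≡ x
  finite⇒⊆ι U s p = eventuallyCyclic⇒∈ι
    (eventuallyCyclic-preserved {𝒜 = algebra U} {ℬ = 𝒜} {f = proj₁} (λ _ → refl)
      (finite⇒eventuallyCyclic {𝒜 = algebra U} s (_ , p)))

  module _ {n} (U : Subalgebra 𝒜) (s : HasSize n U) where

    preimageSubalgebra : Subalgebra 𝒜₂
    preimageSubalgebra = record
      { ∣_∣        = λ y → ι y ∈ ∣ U ∣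
      ; irrelevant = irrelevant U
      -- A finite `U` lies in the range of `ι`, so any member of it has a preimage.
      ; nonempty   = let x , p = nonempty U ; y , eq = finite⇒⊆ι U s p
                     in y , subst (_∈ ∣ U ∣) (sym eq) p
      ; closed     = λ p → subst (_∈ ∣ U ∣) (sym (ι-homo _)) (closed U p)
      }

    corresponds : Corresponds ι preimageSubalgebra U
    corresponds = record
      { image    = id
      ; preimage = λ p → let y , eq = finite⇒⊆ι U s p in y , subst (_∈ ∣ U ∣) (sym eq) p , eq
      }

    finitelyGenerated : FinitelyGenerated preimageSubalgebra
    finitelyGenerated = finite⇒finitelyGenerated preimageSubalgebra
      (n , s ⤖-∘ _≅_.bijection (correspondence preimageSubalgebra U corresponds))

  extend : Automorphism 𝒜₂ → Automorphism 𝒜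
  extend β = ≅-trans e (≅-trans id⊕β (≅-sym e))
    where
    id⊕β : Automorphism (𝒜₁ ⊕ 𝒜₂)
    id⊕β = record
      { bijection = ⤖-id _ ⊎-⤖ _≅_.bijection β
      ; homo      = λ { (inj₁ _) → refl ; (inj₂ y) → cong inj₂ (_≅_.homo β y) }
      }

  extend-ι : ∀ β y → ι (_≅_.to β y) ≡ _≅_.to (extend β) (ι y)
  -- Once `e.to` cancels `e.from`, both sides compute to `e.from (inj₂ (_≅_.to β y))`.
  extend-ι β y rewrite e.to-from (inj₂ y) = refl

  -- Finite subalgebras of `𝒜` correspond to finitely generated ones of `𝒜₂`; `φ` is pulled back,
  -- extended there, and the extension is lifted.
  homogeneous : Homogeneous 𝒜
  homogeneous n _ U V sU sV φ =
    let cU      = corresponds U sU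
        cV      = corresponds V sV
        β , ext = ultrahomogeneous (preimageSubalgebra U sU) (preimageSubalgebra V sV)
                    (finitelyGenerated U sU) (finitelyGenerated V sV) (pull cU cV φ)
    in extend β , lift-extension cU cV φ (extend β) β (extend-ι β) ext

theorem4p13 : ∀ {a} → ExcludedMiddle a →
    (𝒜 : MonounaryAlgebra a) → NonEmpty 𝒜 →
    Homogeneous 𝒜 ⇔
    (∃₂ λ (𝒜₁ 𝒜₂ : MonounaryAlgebra a) →
    CycleFree 𝒜₁ × LocallyFinite 𝒜₂ × Ultrahomogeneous 𝒜₂ × 𝒜 ≅ 𝒜₁ ⊕ 𝒜₂)
theorem4p13 em 𝒜 _ = mk⇔
  (λ hom → cycleFreePart , cyclicPart , cycleFree , locallyFinite , ultrahomogeneous hom , decompose)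
  (λ (_ , _ , cf , _ , uh , e) → Recomposition.homogeneous cf uh e)
  where open Decomposition em 𝒜
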